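{- Let $m$ be a positive integer. In each of the following cases the displayed identity holds, and the triple consisting of $n_1=6m+6$ and the denominators $n_2,n_3$ of the second and third unit fractions on the right-hand side is a wild solution of the Erdős–Straus equation for $24m+1$. (1) If $m=23r+18+c(23r+19)$ with $r,c\in\mathbb N$, then $$\frac{4}{24m+1}=\frac{1}{6m+6}+\frac{1}{(6r+5)(c+1)(24m+1)}+\frac{1}{6(6r+5)(c+1)(23r+19)(24m+1)}.$$ (2) If $m=69r+10+c(69r+11)$ with $r\in\mathbb N$, $r>0$, $c\in\mathbb N$, then $$\frac{4}{24m+1}=\frac{1}{6m+6}+\frac{1}{3(6r+1)(c+1)(24m+1)}+\frac{1}{6(6r+1)(c+1)(69r+11)(24m+1)}.$$ (3) If $m=69r+33+c(69r+34)$ with $r\in\mathbb N$, $r>0$, $c\in\mathbb N$, then $$\frac{4}{24m+1}=\frac{1}{6m+6}+\frac{1}{9(2r+1)(c+1)(24m+1)}+\frac{1}{18(2r+1)(c+1)(69r+34)(24m+1)}.$$ (4) If $m=46r+6+c(46r+7)$ with $r\in\mathbb N$, $r>0$, $c\in\mathbb N$, then $$\frac{4}{24m+1}=\frac{1}{6m+6}+\frac{1}{2(6r+1)(c+1)(24m+1)}+\frac{1}{3(6r+1)(c+1)(46r+7)(24m+1)}.$$ (5) If $m=138r+66+c(138r+67)$ with $r,c\in\mathbb N$, then $$\frac{4}{24m+1}=\frac{1}{6m+6}+\frac{1}{18(2r+1)(c+1)(24m+1)}+\frac{1}{9(2r+1)(c+1)(138r+67)(24m+1)}.$$ (6) If $m=73+74t+92s(t+1)$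 with $s,t\in\mathbb N$, then $$\frac{4}{24m+1}=\frac{1}{6m+6}+\frac{1}{4(6s+5)(t+1)(24m+1)}+\frac{1}{3(6s+5)(t+1)(46s+37)(24m+1)}.$$ (7) If $m=37+38t+92\ell(t+1)$ with $t\in\mathbb N$ and $\ell$ a positive integer such that $3\nmid 46\ell+19$, then $$\frac{4}{24m+1}=\frac{1}{6m+6}+\frac{1}{12(2\ell+1)(t+1)(24m+1)}+\frac{1}{3(2\ell+1)(t+1)(46\ell+19)(24m+1)}.$$ (8) If $m=138r+112+c(138r+113)$ with $r,c\in\mathbb N$, then $$\frac{4}{24m+1}=\frac{1}{6m+6}+\frac{1}{6(6r+5)(c+1)(24m+1)}+\frac{1}{3(6r+5)(c+1)(138r+113)(24m+1)}.$$ (9) If $m=69r+9+c(69r+10)$ with $r\in\mathbb N$, $r>0$, $c\in\mathbb N$, then $$\frac{4}{24m+1}=\frac{1}{6m+6}+\frac{1}{3(6r+1)(c+1)(24m+1)}+\frac{1}{2(6r+1)(c+1)(69r+10)(24m+1)}.$$ (10) If $m=69r+55+c(69r+56)$ with $r\in\mathbb N$, $r>0$, $c\in\mathbb N$, then $$\frac{4}{24m+1}=\frac{1}{6m+6}+\frac{1}{3(6r+5)(c+1)(24m+1)}+\frac{1}{2(6r+5)(c+1)(69r+56)(24m+1)}.$$ (11) If $m=138r+16+c(138r+17)$ with $r\in\mathbb N$, $r>0$, $c\in\mathbb N$, then $$\frac{4}{24m+1}=\frac{1}{6m+6}+\frac{1}{6(6r+1)(c+1)(24m+1)}+\frac{1}{(6r+1)(c+1)(138r+17)(24m+1)}.$$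 (12) If $m=138r+108+c(138r+109)$ with $r\in\mathbb N$, $r>0$, $c\in\mathbb N$, then $$\frac{4}{24m+1}=\frac{1}{6m+6}+\frac{1}{6(6r+5)(c+1)(24m+1)}+\frac{1}{(6r+5)(c+1)(138r+109)(24m+1)}.$$
   Context: $\mathbb N$ denotes the set of nonnegative integers. For a positive integer $m$, the Erdős–Straus equation for $n=24m+1$ is $\frac{4}{n}=\frac1{n_1}+\frac1{n_2}+\frac1{n_3}$ in positive integers $n_1,n_2,n_3$. For $n_1=6m+k$ with $1\le k\le 12m$ one has $\frac{4}{24m+1}=\frac{1}{6m+k}+\frac{4k-1}{(6m+k)(24m+1)}$. A solution $(n_1,n_2,n_3)$ is called a wild solution if $n_1=6m+k$ for some integer $1\le k\le 12m$ and there exist an integer $L\ge 2$ (called a multiplier) and positive integers $J_1,J_2$ (called the numerator summands) such that $J_1+J_2=L(4k-1)$, $\gcd(L,J_1,J_2)=1$, $\frac1{n_2}=\frac{J_1}{L(6m+k)(24m+1)}$ and $\frac1{n_3}=\frac{J_2}{L(6m+k)(24m+1)}$. -}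

module Defs where

open import Data.Integer.Base using (+_)
open import Data.Nat.Base using (ℕ; NonZero; _+_; _*_; _∸_; _≤_; >-nonZero)
open import Data.Nat.GCD using (gcd)
open import Data.Nat.Properties using (m*n≢0; m≤n+m; ≤-trans; n≤1+n)
open import Data.Rational.Base as ℚ using (_/_)
open import Relation.Binary.PropositionalEquality.Core using (_≡_)

-- The identity 4/n = 1/n₁ + 1/n₂ + 1/n₃ in ℚ, together with the positivity of
-- all four denominators, without which the fractions cannot be written.
infix 4 4/_≡1/_+1/_+1/_

record 4/_≡1/_+1/_+1/_ (n n₁ n₂ n₃ : ℕ) : Set where
  field
    {{n≢0}}  : NonZero n
    {{n₁≢0}} : NonZero n₁
    {{n₂≢0}} : NonZero n₂
    {{n₃≢0}} : NonZero n₃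
    identity : (+ 4) / n ≡ (+ 1) / n₁ ℚ.+ (+ 1) / n₂ ℚ.+ (+ 1) / n₃

record IsWildSolution (m n₁ n₂ n₃ : ℕ) : Set where
  field
    isSolution : 4/ (24 * m + 1) ≡1/ n₁ +1/ n₂ +1/ n₃

  open 4/_≡1/_+1/_+1/_ isSolution public

  field
    k       : ℕ
    1≤k     : 1 ≤ k
    k≤12m   : k ≤ 12 * m
    n₁≡6m+k : n₁ ≡ 6 * m + k
    L       : ℕ
    2≤L     : 2 ≤ L
    J₁ J₂   : ℕ
    1≤J₁    : 1 ≤ J₁
    1≤J₂    : 1 ≤ J₂
    -- truncated subtraction is exact here because 1 ≤ k
    J₁+J₂≡L[4k-1] : J₁ + J₂ ≡ L * (4 * k ∸ 1)
    gcd≡1   : gcd L (gcd J₁ J₂) ≡ 1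

  D : ℕ
  D = L * (6 * m + k) * (24 * m + 1)

  instance
    D≢0 : NonZero D
    D≢0 = m*n≢0 (L * (6 * m + k)) (24 * m + 1)
      {{m*n≢0 L (6 * m + k)
        {{>-nonZero (≤-trans (n≤1+n 1) 2≤L)}}
        {{>-nonZero (≤-trans 1≤k (m≤n+m k (6 * m)))}}}}

  field
    1/n₂≡J₁/D : (+ 1) / n₂ ≡ (+ J₁) / D
    1/n₃≡J₂/D : (+ 1) / n₃ ≡ (+ J₂) / D

{-# OPTIONS --safe #-}
module Submission where

open import Data.Integer.Base as ℤ using (+_)
import Data.Integer.Properties as ℤ
open import Data.List.Base using (_∷_; [])
open import Data.Nat using (ℕ; suc; NonZero; _+_; _*_; _∸_; _≤_; _<_; _>_; z≤n; s≤s; >-nonZero; >-nonZero⁻¹)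
open import Data.Nat.Divisibility using (_∤_; _∣_; divides; ∣-trans; *-cancelʳ-∣; >⇒∤; _∣?_)
open import Data.Nat.GCD using (gcd; gcd[m,n]∣m; gcd[m,n]∣n; c*gcd[m,n]≡gcd[cm,cn])
open import Data.Nat.Properties
open import Data.Nat.Tactic.RingSolver using (solve; solve-∀)
open import Data.Product using (_×_; _,_; ∃-syntax)
open import Data.Rational.Base as ℚ using (_/_; toℚᵘ)
import Data.Rational.Properties as ℚ
open import Data.Rational.Unnormalised.Base as ℚᵘ using (mkℚᵘ; *≡*)
import Data.Rational.Unnormalised.Properties as ℚᵘ
open import Relation.Binary.PropositionalEquality
open import Relation.Nullary.Decidable using (from-no)
open import Defs

-- Preliminaries on fractions and common divisors.

cross-multiply : ∀ a d b e {{_ : NonZero d}} {{_ : NonZero e}} →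
  a * e ≡ b * d → + a / d ≡ + b / e
cross-multiply a d@(suc d-1) b e@(suc e-1) ae≡bd =
  ℚ.fromℚᵘ-cong {mkℚᵘ (+ a) d-1} {mkℚᵘ (+ b) e-1}
    (*≡* (trans (sym (ℤ.pos-* a e)) (trans (cong +_ ae≡bd) (ℤ.pos-* b d))))

-- Addition in `ℚ` reduces to lowest terms and so does not compute to the schoolbook formula. The
-- sum is taken in the unnormalised rationals instead, where the denominators agree definitionally
-- and only the integer numerator has to be rewritten.
add-fractions : ∀ a d b e {{_ : NonZero d}} {{_ : NonZero e}} {{_ : NonZero (d * e)}} →
  + a / d ℚ.+ + b / e ≡ + (a * e + b * d) / (d * e)
add-fractions a d@(suc d-1) b e@(suc e-1) = ℚ.toℚᵘ-injective (begin
  toℚᵘ (+ a / d ℚ.+ + b / e)            ≈⟨ ℚ.toℚᵘ-homo-+ (+ a / d) (+ b / e) ⟩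
  toℚᵘ (+ a / d) ℚᵘ.+ toℚᵘ (+ b / e)    ≈⟨ ℚᵘ.+-cong (ℚ.toℚᵘ-fromℚᵘ p) (ℚ.toℚᵘ-fromℚᵘ q) ⟩
  p ℚᵘ.+ q                              ≡⟨ cong (λ i → mkℚᵘ i _) numerator ⟩
  mkℚᵘ (+ (a * e + b * d)) _            ≈⟨ ℚ.toℚᵘ-fromℚᵘ _ ⟨
  toℚᵘ (+ (a * e + b * d) / (d * e))    ∎)
  where
  open ℚᵘ.≃-Reasoning
  p = mkℚᵘ (+ a) d-1
  q = mkℚᵘ (+ b) e-1
  numerator : + a ℤ.* + e ℤ.+ + b ℤ.* + d ≡ + (a * e + b * d)
  numerator = sym (cong₂ ℤ._+_ (ℤ.pos-* a e) (ℤ.pos-* b d))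

-- The gcd is homogeneous: multiplying the gcd of the three quotients by `g` gives back `g` itself,
-- and `g` cancels because it divides the nonzero `a`.
reduce-triple : ∀ a b c {{_ : NonZero a}} →
  ∃[ g ] ∃[ a′ ] ∃[ b′ ] ∃[ c′ ]
    a ≡ a′ * g × b ≡ b′ * g × c ≡ c′ * g × gcd a′ (gcd b′ c′) ≡ 1
reduce-triple a b c {{a≢0}}
  with gcd[m,n]∣m a (gcd b c)
     | ∣-trans (gcd[m,n]∣n a (gcd b c)) (gcd[m,n]∣m b c)
     | ∣-trans (gcd[m,n]∣n a (gcd b c)) (gcd[m,n]∣n b c)
... | divides a′ a≡ | divides b′ b≡ | divides c′ c≡ =
  g , a′ , b′ , c′ , a≡ , b≡ , c≡ , *-cancelˡ-≡ _ 1 g {{g≢0}} (begin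
    g * gcd a′ (gcd b′ c′)                  ≡⟨ c*gcd[m,n]≡gcd[cm,cn] g a′ _ ⟩
    gcd (g * a′) (g * gcd b′ c′)            ≡⟨ cong (gcd (g * a′)) (c*gcd[m,n]≡gcd[cm,cn] g b′ c′) ⟩
    gcd (g * a′) (gcd (g * b′) (g * c′))    ≡⟨ cong₂ gcd (comm a≡) (cong₂ gcd (comm b≡) (comm c≡)) ⟩
    g                                       ≡⟨ *-identityʳ g ⟨
    g * 1                                   ∎)
  where
  open ≡-Reasoning
  g = gcd a (gcd b c)
  g≢0 : NonZero g
  g≢0 = m*n≢0⇒n≢0 a′ {{subst NonZero a≡ a≢0}}
  comm : ∀ {x x′} → x ≡ x′ * g → g * x′ ≡ x
  comm {x′ = x′} eq = trans (*-comm g x′) (sym eq)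

-- Wild solutions for general k.

-- Clearing denominators in 1/n₂ + 1/n₃ = (4k-1)/D, with D = (6m+k)(24m+1), gives
-- J₁ = D n₃, J₂ = D n₂ and L = n₂ n₃; dividing the three by their gcd leaves a
-- multiplier 1 only if L divides J₂, that is, if n₃ divides D.
n₃∤D⇒wild : ∀ m k n₂ n₃ {{_ : NonZero n₃}} → 1 ≤ k → k ≤ 12 * m →
  n₃ ∤ (6 * m + k) * (24 * m + 1) →
  (6 * m + k) * (24 * m + 1) * (n₂ + n₃) ≡ (4 * k ∸ 1) * (n₂ * n₃) →
  IsWildSolution m (6 * m + k) n₂ n₃
n₃∤D⇒wild m k n₂ n₃ 1≤k k≤12m n₃∤D split = build (reduce-triple (n₂ * n₃) (D * n₃) (D * n₂))
  where
  open ≡-Reasoning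
  n  = 24 * m + 1
  n₁ = 6 * m + k
  D  = n₁ * n
  K  = 4 * k ∸ 1

  instance
    n≢0 : NonZero n
    n≢0 = >-nonZero (m≤n+m 1 (24 * m))
    n₁≢0 : NonZero n₁
    n₁≢0 = >-nonZero (≤-trans 1≤k (m≤n+m k (6 * m)))
    D≢0 : NonZero D
    D≢0 = m*n≢0 n₁ n
    -- Positivity of `n₂` is read off from `split`: its left side is nonzero because `D` and `n₃`
    -- are, so every factor on the right is nonzero too.
    Kn₂n₃≢0 : NonZero (K * (n₂ * n₃))
    Kn₂n₃≢0 = subst NonZero split
      (m*n≢0 D (n₂ + n₃) {{D≢0}} {{>-nonZero (≤-trans (>-nonZero⁻¹ n₃) (m≤n+m n₃ n₂))}})
    n₂n₃≢0 : NonZero (n₂ * n₃)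
    n₂n₃≢0 = m*n≢0⇒n≢0 K
    n₂≢0 : NonZero n₂
    n₂≢0 = m*n≢0⇒m≢0 n₂ {n₃}
    n₁n₂≢0 : NonZero (n₁ * n₂)
    n₁n₂≢0 = m*n≢0 n₁ n₂
    n₁n₂n₃≢0 : NonZero (n₁ * n₂ * n₃)
    n₁n₂n₃≢0 = m*n≢0 (n₁ * n₂) n₃

  -- This is 4/n = 1/n₁ + K/(n₁n) with denominators cleared. The truncated subtraction in `K` is
  -- exact because `1≤k`.
  K+n≡4n₁ : K + n ≡ 4 * n₁
  K+n≡4n₁ = begin
    K + (24 * m + 1)    ≡⟨ swap K (24 * m) ⟩
    24 * m + (K + 1)    ≡⟨ cong (_+_ (24 * m)) (m∸n+n≡m (≤-trans 1≤k (m≤n*m k 4))) ⟩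
    24 * m + 4 * k      ≡⟨ collect m k ⟩
    4 * n₁              ∎
    where
    swap : ∀ x y → x + (y + 1) ≡ y + (x + 1)
    swap = solve-∀
    collect : ∀ x y → 24 * x + 4 * y ≡ 4 * (6 * x + y)
    collect = solve-∀

  solution : 4/ n ≡1/ n₁ +1/ n₂ +1/ n₃
  solution = record { identity = sym (begin
      + 1 / n₁ ℚ.+ + 1 / n₂ ℚ.+ + 1 / n₃
        ≡⟨ cong (ℚ._+ + 1 / n₃) (add-fractions 1 n₁ 1 n₂) ⟩
      + (1 * n₂ + 1 * n₁) / (n₁ * n₂) ℚ.+ + 1 / n₃
        ≡⟨ add-fractions (1 * n₂ + 1 * n₁) (n₁ * n₂) 1 n₃ ⟩
      + ((1 * n₂ + 1 * n₁) * n₃ + 1 * (n₁ * n₂)) / (n₁ * n₂ * n₃)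
        ≡⟨ cross-multiply ((1 * n₂ + 1 * n₁) * n₃ + 1 * (n₁ * n₂)) (n₁ * n₂ * n₃) 4 n cleared ⟩
      + 4 / n ∎) }
    where
    expand : ∀ x y z w →
      ((1 * y + 1 * x) * z + 1 * (x * y)) * w ≡ x * w * (y + z) + w * (y * z)
    expand = solve-∀
    -- The left side is `D * (n₂ + n₃) + n * (n₂ * n₃)`. By `split` the first summand is
    -- `K * (n₂ * n₃)`, so the total coefficient of `n₂ * n₃` is `K + n`, which is `4 * n₁`.
    cleared : ((1 * n₂ + 1 * n₁) * n₃ + 1 * (n₁ * n₂)) * n ≡ 4 * (n₁ * n₂ * n₃)
    cleared = begin
      ((1 * n₂ + 1 * n₁) * n₃ + 1 * (n₁ * n₂)) * n ≡⟨ expand n₁ n₂ n₃ n ⟩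
      D * (n₂ + n₃) + n * (n₂ * n₃)                ≡⟨ cong (_+ n * (n₂ * n₃)) split ⟩
      K * (n₂ * n₃) + n * (n₂ * n₃)                ≡⟨ *-distribʳ-+ (n₂ * n₃) K n ⟨
      (K + n) * (n₂ * n₃)                          ≡⟨ cong (_* (n₂ * n₃)) K+n≡4n₁ ⟩
      4 * n₁ * (n₂ * n₃)                           ≡⟨ regroup n₁ n₂ n₃ ⟩
      4 * (n₁ * n₂ * n₃)                           ∎
      where
      regroup : ∀ x y z → 4 * x * (y * z) ≡ 4 * (x * y * z)
      regroup = solve-∀

  build : (∃[ g ] ∃[ L ] ∃[ J₁ ] ∃[ J₂ ]
      n₂ * n₃ ≡ L * g × D * n₃ ≡ J₁ * g × D * n₂ ≡ J₂ * g × gcd L (gcd J₁ J₂) ≡ 1) →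
    IsWildSolution m n₁ n₂ n₃
  build (g , L , J₁ , J₂ , L-eq , J₁-eq , J₂-eq , coprime) = record
    { isSolution = solution
    ; k = k ; 1≤k = 1≤k ; k≤12m = k≤12m ; n₁≡6m+k = refl
    ; L = L ; 2≤L = 2≤L
    ; J₁ = J₁ ; J₂ = J₂ ; 1≤J₁ = 1≤J₁ ; 1≤J₂ = 1≤J₂
    ; J₁+J₂≡L[4k-1] = *-cancelʳ-≡ _ _ g sum
    ; gcd≡1 = coprime
    ; 1/n₂≡J₁/D = cross-multiply 1 n₂ J₁ (L * n₁ * n) (over n₂ J₁ (begin
        n₂ * n₃ * D    ≡⟨ comm n₂ n₃ D ⟩
        D * n₃ * n₂    ∎) J₁-eq)
    ; 1/n₃≡J₂/D = cross-multiply 1 n₃ J₂ (L * n₁ * n) (over n₃ J₂ (begin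
        n₂ * n₃ * D    ≡⟨ *-comm (n₂ * n₃) D ⟩
        D * (n₂ * n₃)  ≡⟨ *-assoc D n₂ n₃ ⟨
        D * n₂ * n₃    ∎) J₂-eq)
    }
    where
    instance
      Lg≢0 : NonZero (L * g)
      Lg≢0 = subst NonZero L-eq n₂n₃≢0
      g≢0 : NonZero g
      g≢0 = m*n≢0⇒n≢0 L
      Ln₁n≢0 : NonZero (L * n₁ * n)
      Ln₁n≢0 = m*n≢0 (L * n₁) n {{m*n≢0 L n₁ {{m*n≢0⇒m≢0 L {g}}}}}
    1≤J₁ : 1 ≤ J₁
    1≤J₁ = >-nonZero⁻¹ J₁ {{m*n≢0⇒m≢0 J₁ {g} {{subst NonZero J₁-eq (m*n≢0 D n₃)}}}}
    1≤J₂ : 1 ≤ J₂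
    1≤J₂ = >-nonZero⁻¹ J₂ {{m*n≢0⇒m≢0 J₂ {g} {{subst NonZero J₂-eq (m*n≢0 D n₂)}}}}
    2≤L : 2 ≤ L
    -- `L` is positive, so only `L = 1` has to be excluded. There `g` would equal `n₂ * n₃`, and
    -- cancelling `n₂` in `D * n₂ ≡ J₂ * g` would exhibit `n₃` as a divisor of `D` with quotient
    -- `J₂`.
    2≤L = ≤∧≢⇒< (>-nonZero⁻¹ L {{m*n≢0⇒m≢0 L {g}}}) λ 1≡L →
      n₃∤D (divides J₂ (*-cancelʳ-≡ D (J₂ * n₃) n₂ (begin
        D * n₂            ≡⟨ J₂-eq ⟩
        J₂ * g            ≡⟨ cong (J₂ *_) (*-identityˡ g) ⟨
        J₂ * (1 * g)      ≡⟨ cong (λ x → J₂ * (x * g)) 1≡L ⟩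
        J₂ * (L * g)      ≡⟨ cong (J₂ *_) L-eq ⟨
        J₂ * (n₂ * n₃)    ≡⟨ cong (J₂ *_) (*-comm n₂ n₃) ⟩
        J₂ * (n₃ * n₂)    ≡⟨ *-assoc J₂ n₃ n₂ ⟨
        J₂ * n₃ * n₂      ∎)))
    comm : ∀ x y z → x * y * z ≡ z * y * x
    comm = solve-∀
    -- Scaled by `g`, the condition on the numerator summands is `split` itself.
    sum : (J₁ + J₂) * g ≡ L * K * g
    sum = begin
      (J₁ + J₂) * g      ≡⟨ *-distribʳ-+ g J₁ J₂ ⟩
      J₁ * g + J₂ * g    ≡⟨ cong₂ _+_ J₁-eq J₂-eq ⟨
      D * n₃ + D * n₂    ≡⟨ *-distribˡ-+ D n₃ n₂ ⟨
      D * (n₃ + n₂)      ≡⟨ cong (D *_) (+-comm n₃ n₂) ⟩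
      D * (n₂ + n₃)      ≡⟨ split ⟩
      K * (n₂ * n₃)      ≡⟨ cong (K *_) L-eq ⟩
      K * (L * g)        ≡⟨ *-assoc K L g ⟨
      K * L * g          ≡⟨ cong (_* g) (*-comm K L) ⟩
      L * K * g          ∎
    -- Scaled by `g`, both sides equal `n₂ * n₃ * D`. Here `d` is the unreduced numerator `J * g`:
    -- it is `D * n₃` for `n₂` and `D * n₂` for `n₃`.
    over : ∀ nᵢ J {d} → n₂ * n₃ * D ≡ d * nᵢ → d ≡ J * g → 1 * (L * n₁ * n) ≡ J * nᵢ
    over nᵢ J {d} eq d≡Jg = *-cancelʳ-≡ _ _ g (begin
      1 * (L * n₁ * n) * g    ≡⟨ shuffle L n₁ n g ⟩
      L * g * D               ≡⟨ cong (_* D) L-eq ⟨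
      n₂ * n₃ * D             ≡⟨ eq ⟩
      d * nᵢ                  ≡⟨ cong (_* nᵢ) d≡Jg ⟩
      J * g * nᵢ              ≡⟨ shuffle′ J g nᵢ ⟩
      J * nᵢ * g              ∎)
      where
      shuffle : ∀ x y z w → 1 * (x * y * z) * w ≡ x * w * (y * z)
      shuffle = solve-∀
      shuffle′ : ∀ x y z → x * y * z ≡ x * z * y
      shuffle′ = solve-∀

-- Specialisation to k = 6.

-- The case k = 6, where 4k - 1 = 23: both sides of the cleared equation contain
-- C² q (24m+1)², and n₃ ∣ D becomes v ∣ E.
v∤E⇒wild : ∀ m E C q u v {{_ : NonZero v}} → m > 0 → 6 * m + 6 ≡ E * (C * q) → v ∤ E →
  E * (u + v * q) ≡ 23 * (u * v) →
  let n₂ = u * C * (24 * m + 1)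
      n₃ = v * C * q * (24 * m + 1)
  in (4/ (24 * m + 1) ≡1/ (6 * m + 6) +1/ n₂ +1/ n₃) × IsWildSolution m (6 * m + 6) n₂ n₃
v∤E⇒wild m E C q u v m>0 n₁≡ECq v∤E eq = IsWildSolution.isSolution wild , wild
  where
  n = 24 * m + 1
  Cqn = C * q * n

  n₁n≡ECqn : (6 * m + 6) * n ≡ E * Cqn
  n₁n≡ECqn = trans (cong (_* n) n₁≡ECq) (*-assoc E (C * q) n)

  n₃≡vCqn : v * C * q * n ≡ v * Cqn
  n₃≡vCqn = trans (cong (_* n) (*-assoc v C q)) (*-assoc v (C * q) n)

  instance
    -- `C * q` is nonzero as a factor of `6 * m + 6`.
    Cqn≢0 : NonZero Cqn
    Cqn≢0 = m*n≢0 (C * q) n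
      {{m*n≢0⇒n≢0 E {{subst NonZero n₁≡ECq (>-nonZero (≤-trans (m≤m+n 1 5) (m≤n+m 6 (6 * m))))}}}}
      {{>-nonZero (m≤n+m 1 (24 * m))}}
    n₃≢0 : NonZero (v * C * q * n)
    n₃≢0 = subst NonZero (sym n₃≡vCqn) (m*n≢0 v Cqn)

  n₃∤D : v * C * q * n ∤ (6 * m + 6) * n
  n₃∤D n₃∣D = v∤E (*-cancelʳ-∣ Cqn (subst₂ _∣_ n₃≡vCqn n₁n≡ECqn n₃∣D))

  factorˡ : ∀ E C q u v n →
    E * (C * q * n) * (u * C * n + v * C * q * n) ≡ E * (u + v * q) * (C * C * q * n * n)
  factorˡ = solve-∀

  factorʳ : ∀ C q u v n →
    23 * (u * v) * (C * C * q * n * n) ≡ 23 * (u * C * n * (v * C * q * n))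
  factorʳ = solve-∀

  split : (6 * m + 6) * n * (u * C * n + v * C * q * n) ≡ 23 * (u * C * n * (v * C * q * n))
  split = begin
    (6 * m + 6) * n * (u * C * n + v * C * q * n)
      ≡⟨ cong (_* (u * C * n + v * C * q * n)) n₁n≡ECqn ⟩
    E * Cqn * (u * C * n + v * C * q * n)
      ≡⟨ factorˡ E C q u v n ⟩
    E * (u + v * q) * (C * C * q * n * n)
      ≡⟨ cong (_* (C * C * q * n * n)) eq ⟩
    23 * (u * v) * (C * C * q * n * n)
      ≡⟨ factorʳ C q u v n ⟩
    23 * (u * C * n * (v * C * q * n)) ∎
    where open ≡-Reasoning

  wild : IsWildSolution m (6 * m + 6) (u * C * n) (v * C * q * n)
  wild = n₃∤D⇒wild m 6 _ _ (m≤m+n 1 5) (≤-trans (m≤m+n 6 6) (*-monoʳ-≤ 12 m>0)) n₃∤D split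

-- A positive number has no divisor larger than itself, and `E` is positive as a factor of
-- `6 * m + 6`. This covers every family except the seventh.
E<v⇒wild : ∀ m E C q u v → m > 0 → 6 * m + 6 ≡ E * (C * q) → E < v →
  E * (u + v * q) ≡ 23 * (u * v) →
  let n₂ = u * C * (24 * m + 1)
      n₃ = v * C * q * (24 * m + 1)
  in (4/ (24 * m + 1) ≡1/ (6 * m + 6) +1/ n₂ +1/ n₃) × IsWildSolution m (6 * m + 6) n₂ n₃
E<v⇒wild m E C q u v m>0 n₁≡ECq E<v =
  v∤E⇒wild m E C q u v {{>-nonZero (m<n⇒0<n E<v)}} m>0 n₁≡ECq
    (>⇒∤ {{E≢0}} E<v)
  where
  E≢0 : NonZero E
  E≢0 = m*n≢0⇒m≢0 E {C * q}
    {{subst NonZero n₁≡ECq (>-nonZero (≤-trans (m≤m+n 1 5) (m≤n+m 6 (6 * m))))}}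

-- The divisor is 9 at `ℓ = 1`, which is below 12 and has to be checked separately; from `ℓ = 2` on
-- it is at least 15.
3[2ℓ+1]∤12 : ∀ ℓ → ℓ > 0 → 3 * (2 * ℓ + 1) ∤ 12
3[2ℓ+1]∤12 1                  _ = from-no (9 ∣? 12)
3[2ℓ+1]∤12 ℓ@(suc (suc _))    _ = >⇒∤ (≤-trans (m≤m+n 13 2)
  (*-monoʳ-≤ 3 (+-monoˡ-≤ 1 (*-monoʳ-≤ 2 {2} {ℓ} (s≤s (s≤s z≤n))))))

-- The twelve families.

theorem4p2 : (m : ℕ) → m > 0 →
    ((r c : ℕ) → m ≡ 23 * r + 18 + c * (23 * r + 19) →
      let n₂ = (6 * r + 5) * (c + 1) * (24 * m + 1)
          n₃ = 6 * (6 * r + 5) * (c + 1) * (23 * r + 19) * (24 * m + 1)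
      in (4/ (24 * m + 1) ≡1/ (6 * m + 6) +1/ n₂ +1/ n₃) × IsWildSolution m (6 * m + 6) n₂ n₃)
  × ((r c : ℕ) → r > 0 → m ≡ 69 * r + 10 + c * (69 * r + 11) →
      let n₂ = 3 * (6 * r + 1) * (c + 1) * (24 * m + 1)
          n₃ = 6 * (6 * r + 1) * (c + 1) * (69 * r + 11) * (24 * m + 1)
      in (4/ (24 * m + 1) ≡1/ (6 * m + 6) +1/ n₂ +1/ n₃) × IsWildSolution m (6 * m + 6) n₂ n₃)
  × ((r c : ℕ) → r > 0 → m ≡ 69 * r + 33 + c * (69 * r + 34) →
      let n₂ = 9 * (2 * r + 1) * (c + 1) * (24 * m + 1)
          n₃ = 18 * (2 * r + 1) * (c + 1) * (69 * r + 34) * (24 * m + 1)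
      in (4/ (24 * m + 1) ≡1/ (6 * m + 6) +1/ n₂ +1/ n₃) × IsWildSolution m (6 * m + 6) n₂ n₃)
  × ((r c : ℕ) → r > 0 → m ≡ 46 * r + 6 + c * (46 * r + 7) →
      let n₂ = 2 * (6 * r + 1) * (c + 1) * (24 * m + 1)
          n₃ = 3 * (6 * r + 1) * (c + 1) * (46 * r + 7) * (24 * m + 1)
      in (4/ (24 * m + 1) ≡1/ (6 * m + 6) +1/ n₂ +1/ n₃) × IsWildSolution m (6 * m + 6) n₂ n₃)
  × ((r c : ℕ) → m ≡ 138 * r + 66 + c * (138 * r + 67) →
      let n₂ = 18 * (2 * r + 1) * (c + 1) * (24 * m + 1)
          n₃ = 9 * (2 * r + 1) * (c + 1) * (138 * r + 67) * (24 * m + 1)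
      in (4/ (24 * m + 1) ≡1/ (6 * m + 6) +1/ n₂ +1/ n₃) × IsWildSolution m (6 * m + 6) n₂ n₃)
  × ((s t : ℕ) → m ≡ 73 + 74 * t + 92 * s * (t + 1) →
      let n₂ = 4 * (6 * s + 5) * (t + 1) * (24 * m + 1)
          n₃ = 3 * (6 * s + 5) * (t + 1) * (46 * s + 37) * (24 * m + 1)
      in (4/ (24 * m + 1) ≡1/ (6 * m + 6) +1/ n₂ +1/ n₃) × IsWildSolution m (6 * m + 6) n₂ n₃)
  × ((t ℓ : ℕ) → ℓ > 0 → 3 ∤ 46 * ℓ + 19 → m ≡ 37 + 38 * t + 92 * ℓ * (t + 1) →
      let n₂ = 12 * (2 * ℓ + 1) * (t + 1) * (24 * m + 1)
          n₃ = 3 * (2 * ℓ + 1) * (t + 1) * (46 * ℓ + 19) * (24 * m + 1)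
      in (4/ (24 * m + 1) ≡1/ (6 * m + 6) +1/ n₂ +1/ n₃) × IsWildSolution m (6 * m + 6) n₂ n₃)
  × ((r c : ℕ) → m ≡ 138 * r + 112 + c * (138 * r + 113) →
      let n₂ = 6 * (6 * r + 5) * (c + 1) * (24 * m + 1)
          n₃ = 3 * (6 * r + 5) * (c + 1) * (138 * r + 113) * (24 * m + 1)
      in (4/ (24 * m + 1) ≡1/ (6 * m + 6) +1/ n₂ +1/ n₃) × IsWildSolution m (6 * m + 6) n₂ n₃)
  × ((r c : ℕ) → r > 0 → m ≡ 69 * r + 9 + c * (69 * r + 10) →
      let n₂ = 3 * (6 * r + 1) * (c + 1) * (24 * m + 1)
          n₃ = 2 * (6 * r + 1) * (c + 1) * (69 * r + 10) * (24 * m + 1)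
      in (4/ (24 * m + 1) ≡1/ (6 * m + 6) +1/ n₂ +1/ n₃) × IsWildSolution m (6 * m + 6) n₂ n₃)
  × ((r c : ℕ) → r > 0 → m ≡ 69 * r + 55 + c * (69 * r + 56) →
      let n₂ = 3 * (6 * r + 5) * (c + 1) * (24 * m + 1)
          n₃ = 2 * (6 * r + 5) * (c + 1) * (69 * r + 56) * (24 * m + 1)
      in (4/ (24 * m + 1) ≡1/ (6 * m + 6) +1/ n₂ +1/ n₃) × IsWildSolution m (6 * m + 6) n₂ n₃)
  × ((r c : ℕ) → r > 0 → m ≡ 138 * r + 16 + c * (138 * r + 17) →
      let n₂ = 6 * (6 * r + 1) * (c + 1) * (24 * m + 1)
          n₃ = (6 * r + 1) * (c + 1) * (138 * r + 17) * (24 * m + 1)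
      in (4/ (24 * m + 1) ≡1/ (6 * m + 6) +1/ n₂ +1/ n₃) × IsWildSolution m (6 * m + 6) n₂ n₃)
  × ((r c : ℕ) → r > 0 → m ≡ 138 * r + 108 + c * (138 * r + 109) →
      let n₂ = 6 * (6 * r + 5) * (c + 1) * (24 * m + 1)
          n₃ = (6 * r + 5) * (c + 1) * (138 * r + 109) * (24 * m + 1)
      in (4/ (24 * m + 1) ≡1/ (6 * m + 6) +1/ n₂ +1/ n₃) × IsWildSolution m (6 * m + 6) n₂ n₃)
theorem4p2 m m>0 =
    -- Here `m + 1` factors as `(c + 1) * q` with `q = 23 * r + 19`, so `6 * m + 6` is
    -- `6 * ((c + 1) * q)` and `E` is 6. The last equation reduces to
    -- `1 + 6 * q ≡ 23 * (6 * r + 5)`. The other families with `E = 6` follow the same pattern.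
    (λ r c eq → E<v⇒wild m 6 (c + 1) (23 * r + 19) (6 * r + 5) (6 * (6 * r + 5)) m>0
      (trans (cong (λ x → 6 * x + 6) eq) (solve (r ∷ c ∷ [])))
      (≤-trans (m≤m+n 7 23) (*-monoʳ-≤ 6 (m≤n+m 5 (6 * r)))) (solve (r ∷ [])))
  , (λ r c r>0 eq → E<v⇒wild m 6 (c + 1) (69 * r + 11) (3 * (6 * r + 1)) (6 * (6 * r + 1)) m>0
      (trans (cong (λ x → 6 * x + 6) eq) (solve (r ∷ c ∷ [])))
      -- At `r = 0` the value of `v` would be 6, a divisor of `E`; `r>0` raises it to at least 42.
      (≤-trans (m≤m+n 7 35) (*-monoʳ-≤ 6 (+-monoˡ-≤ 1 (*-monoʳ-≤ 6 r>0)))) (solve (r ∷ [])))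
  , (λ r c r>0 eq → E<v⇒wild m 6 (c + 1) (69 * r + 34) (9 * (2 * r + 1)) (18 * (2 * r + 1)) m>0
      (trans (cong (λ x → 6 * x + 6) eq) (solve (r ∷ c ∷ [])))
      (≤-trans (m≤m+n 7 47) (*-monoʳ-≤ 18 (+-monoˡ-≤ 1 (*-monoʳ-≤ 2 r>0)))) (solve (r ∷ [])))
  , (λ r c r>0 eq → E<v⇒wild m 6 (c + 1) (46 * r + 7) (2 * (6 * r + 1)) (3 * (6 * r + 1)) m>0
      (trans (cong (λ x → 6 * x + 6) eq) (solve (r ∷ c ∷ [])))
      (≤-trans (m≤m+n 7 14) (*-monoʳ-≤ 3 (+-monoˡ-≤ 1 (*-monoʳ-≤ 6 r>0)))) (solve (r ∷ [])))
  , (λ r c eq → E<v⇒wild m 6 (c + 1) (138 * r + 67) (18 * (2 * r + 1)) (9 * (2 * r + 1)) m>0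
      (trans (cong (λ x → 6 * x + 6) eq) (solve (r ∷ c ∷ [])))
      (≤-trans (m≤m+n 7 2) (*-monoʳ-≤ 9 (m≤n+m 1 (2 * r)))) (solve (r ∷ [])))
  -- Now `m + 1` is `2 * (t + 1) * (46 * s + 37)`; the extra 2 makes `E` equal to 12.
  , (λ s t eq → E<v⇒wild m 12 (t + 1) (46 * s + 37) (4 * (6 * s + 5)) (3 * (6 * s + 5)) m>0
      (trans (cong (λ x → 6 * x + 6) eq) (solve (s ∷ t ∷ [])))
      (≤-trans (m≤m+n 13 2) (*-monoʳ-≤ 3 (m≤n+m 5 (6 * s)))) (solve (s ∷ [])))
  -- Again `E` is 12, but `v = 3 * (2 * ℓ + 1)` is only 9 at `ℓ = 1`, so a comparison of sizes fails
  -- there and non-divisibility is used directly.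
  , (λ t ℓ ℓ>0 _ eq → v∤E⇒wild m 12 (t + 1) (46 * ℓ + 19) (12 * (2 * ℓ + 1)) (3 * (2 * ℓ + 1))
      {{>-nonZero (≤-trans (m≤m+n 1 2) (*-monoʳ-≤ 3 (m≤n+m 1 (2 * ℓ))))}} m>0
      (trans (cong (λ x → 6 * x + 6) eq) (solve (t ∷ ℓ ∷ [])))
      (3[2ℓ+1]∤12 ℓ ℓ>0) (solve (ℓ ∷ [])))
  , (λ r c eq → E<v⇒wild m 6 (c + 1) (138 * r + 113) (6 * (6 * r + 5)) (3 * (6 * r + 5)) m>0
      (trans (cong (λ x → 6 * x + 6) eq) (solve (r ∷ c ∷ [])))
      (≤-trans (m≤m+n 7 8) (*-monoʳ-≤ 3 (m≤n+m 5 (6 * r)))) (solve (r ∷ [])))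
  , (λ r c r>0 eq → E<v⇒wild m 6 (c + 1) (69 * r + 10) (3 * (6 * r + 1)) (2 * (6 * r + 1)) m>0
      (trans (cong (λ x → 6 * x + 6) eq) (solve (r ∷ c ∷ [])))
      (≤-trans (m≤m+n 7 7) (*-monoʳ-≤ 2 (+-monoˡ-≤ 1 (*-monoʳ-≤ 6 r>0)))) (solve (r ∷ [])))
  , (λ r c r>0 eq → E<v⇒wild m 6 (c + 1) (69 * r + 56) (3 * (6 * r + 5)) (2 * (6 * r + 5)) m>0
      (trans (cong (λ x → 6 * x + 6) eq) (solve (r ∷ c ∷ [])))
      (≤-trans (m≤m+n 7 15) (*-monoʳ-≤ 2 (+-monoˡ-≤ 5 (*-monoʳ-≤ 6 r>0)))) (solve (r ∷ [])))
  , (λ r c r>0 eq → E<v⇒wild m 6 (c + 1) (138 * r + 17) (6 * (6 * r + 1)) (6 * r + 1) m>0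
      (trans (cong (λ x → 6 * x + 6) eq) (solve (r ∷ c ∷ [])))
      -- The bound is tight: at `r = 1` the value of `v` is 7, just above `E`.
      (+-monoˡ-≤ 1 (*-monoʳ-≤ 6 r>0)) (solve (r ∷ [])))
  , (λ r c r>0 eq → E<v⇒wild m 6 (c + 1) (138 * r + 109) (6 * (6 * r + 5)) (6 * r + 5) m>0
      (trans (cong (λ x → 6 * x + 6) eq) (solve (r ∷ c ∷ [])))
      (≤-trans (m≤m+n 7 4) (+-monoˡ-≤ 5 (*-monoʳ-≤ 6 r>0))) (solve (r ∷ [])))
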